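{- A finite simple graph $G$ belongs to $\mathcal{G}_2$ if and only if $G$ has a family of cliques covering every edge of $G$ such that every clique in the family contains a simplicial vertex of $G$.
   Context: A finite topology $\tau$ on a finite set $X$ is a family of subsets of $X$ (the open sets) containing $\emptyset$ and $X$ and closed under unions and intersections. Distinct $x,y\in X$ are $T_2$-separated if there exist disjoint open sets $U_x\ni x$ and $U_y\ni y$. $G_2(\tau)$ is the simple graph with vertex set $X$ in which distinct $x,y$ are adjacent iff they are not $T_2$-separated; $\mathcal{G}_2$ is the class of graphs isomorphic to $G_2(\tau)$ for some finite topology $\tau$. A vertex $v$ of $G$ is simplicial if its closed neighborhood $N[v]$ induces a clique. -}

module Defs where

open import Data.Fin.Base using (Fin)
open import Data.Fin.Properties using (_≟_)
open import Data.Fin.Subset using (Subset; _∈_; _∩_; _∪_; ⊥; ⊤; Empty)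
open import Data.Fin.Subset.Properties using (_∈?_; anySubset?; nonempty?; ∩-comm)
open import Data.Nat.Base using (ℕ)
open import Data.Product.Base using (Σ-syntax; ∃-syntax; _×_; _,_)
open import Data.Sum.Base using (_⊎_)
open import Function.Bundles using (_↔_; _⇔_; Inverse)
open import Level using (0ℓ)
open import Relation.Binary.Core using (Rel)
import Relation.Binary.Definitions as Binary
open import Relation.Binary.PropositionalEquality using (_≡_; _≢_; refl; sym; subst)
open import Relation.Nullary.Decidable using (_×-dec_; ¬?)
open import Relation.Nullary.Negation using (¬_)
open import Relation.Unary using (Pred; Decidable)

-- Finite sets are taken to be of the form Fin n.  Families of subsets and
-- adjacency relations are decidable, as they are classically on a finite set.

record Graph (n : ℕ) : Set₁ where
  field
    Adj    : Rel (Fin n) 0ℓ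
    adj?   : Binary.Decidable Adj
    symm   : ∀ {x y} → Adj x y → Adj y x
    irrefl : ∀ {x} → ¬ Adj x x

open Graph public

record _≅_ {m n : ℕ} (G : Graph m) (H : Graph n) : Set where
  field
    bijection : Fin m ↔ Fin n
    adj⇔      : ∀ x y →
                Adj G x y ⇔ Adj H (Inverse.to bijection x) (Inverse.to bijection y)

-- There are only finitely many subsets, so ∅ together with binary unions
-- accounts for arbitrary unions.

record Topology (n : ℕ) : Set₁ where
  field
    Open     : Pred (Subset n) 0ℓ
    open?    : Decidable Open
    ∅-open   : Open ⊥
    X-open   : Open ⊤
    ∪-closed : ∀ {U V} → Open U → Open V → Open (U ∪ V)
    ∩-closed : ∀ {U V} → Open U → Open V → Open (U ∩ V)

open Topology public

module _ {n : ℕ} (τ : Topology n) where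

  T₂-Separated : Rel (Fin n) 0ℓ
  T₂-Separated x y =
    ∃[ U ] ∃[ V ] Open τ U × Open τ V × x ∈ U × y ∈ V × Empty (U ∩ V)

  T₂-separated? : Binary.Decidable T₂-Separated
  T₂-separated? x y = anySubset? λ U → anySubset? λ V →
    open? τ U ×-dec open? τ V ×-dec x ∈? U ×-dec y ∈? V ×-dec
    ¬? (nonempty? (U ∩ V))

  T₂-separated-sym : ∀ {x y} → T₂-Separated x y → T₂-Separated y x
  T₂-separated-sym (U , V , oU , oV , x∈U , y∈V , disjoint) =
    V , U , oV , oU , y∈V , x∈U ,
    λ (z , z∈V∩U) → disjoint (z , subst (z ∈_) (∩-comm V U) z∈V∩U)

  G₂ : Graph n
  G₂ .Adj x y              = x ≢ y × ¬ T₂-Separated x y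
  G₂ .adj? x y             = ¬? (x ≟ y) ×-dec ¬? (T₂-separated? x y)
  G₂ .symm (x≢y , ¬sep)    = (λ y≡x → x≢y (sym y≡x)) , λ sep → ¬sep (T₂-separated-sym sep)
  G₂ .irrefl (x≢x , _)     = x≢x refl

𝒢₂ : ∀ {n} → Graph n → Set₁
𝒢₂ G = ∃[ m ] Σ[ τ ∈ Topology m ] G ≅ G₂ τ

module _ {n : ℕ} (G : Graph n) where

  Clique : Pred (Fin n) 0ℓ → Set
  Clique P = ∀ {x y} → P x → P y → x ≢ y → Adj G x y

  N[_] : Fin n → Pred (Fin n) 0ℓ
  N[ v ] u = u ≡ v ⊎ Adj G v u

  Simplicial : Pred (Fin n) 0ℓ
  Simplicial v = Clique N[ v ]

  record SimplicialCliqueCover : Set₁ where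
    field
      Family     : Pred (Subset n) 0ℓ
      family?    : Decidable Family
      cliques    : ∀ {C} → Family C → Clique (_∈ C)
      covers     : ∀ {x y} → Adj G x y → ∃[ C ] Family C × x ∈ C × y ∈ C
      simplicial : ∀ {C} → Family C → ∃[ v ] v ∈ C × Simplicial v

{-# OPTIONS --safe #-}

-- Both sides say that every edge xy lies in the closed neighbourhood of a
-- simplicial vertex.  For a topology, let x and y be non-separated, let U and V
-- be their least open neighbourhoods, and let W be a minimal nonempty open set
-- inside U ∩ V.  Any z ∈ W is simplicial: an open neighbourhood of a vertex of
-- N[z] meets W, hence contains W, so no two vertices of N[z] can be separated.
-- Conversely, take as open the sets that contain, along with x, all simplicial
-- vertices of N[x].
module Submission where

open import Data.Bool.Base using (true)
open import Data.Fin.Base using (Fin)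
open import Data.Fin.Properties using (_≟_; all?; any?)
open import Data.Fin.Subset
  using (Subset; _∈_; _⊆_; _⊂_; _∩_; Nonempty)
open import Data.Fin.Subset.Induction using (⊂-wellFounded; Acc; acc)
open import Data.Fin.Subset.Properties
  using (_∈?_; _⊂?_; anySubset?; nonempty?; ∉⊥; ∈⊤; ⊆-refl; ⊆-trans;
         p∩q⊆p; p∩q⊆q; x∈p∩q⁺; x∈p∩q⁻; x∈p∪q⁺; x∈p∪q⁻)
open import Data.Nat.Base using (ℕ)
open import Data.Product.Base using (∃-syntax; _×_; _,_; proj₁; proj₂)
open import Data.Sum.Base using (_⊎_; inj₁; inj₂)
import Data.Sum.Base as Sum
open import Data.Vec.Base using (tabulate)
open import Data.Vec.Properties using ([]=⇒lookup; lookup⇒[]=; lookup∘tabulate)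
open import Function.Base using (_∘_)
open import Function.Bundles using (_⇔_; Equivalence; Inverse; mk⇔)
import Function.Construct.Identity as Identity
open import Level using (0ℓ)
open import Relation.Binary.PropositionalEquality
  using (_≡_; _≢_; refl; sym; trans; cong; subst)
open import Relation.Nullary.Decidable
  using (Dec; yes; no; does; map′; ¬?; _×-dec_; _⊎-dec_; _→-dec_; dec-true; decidable-stable)
open import Relation.Nullary.Negation using (¬_; contradiction)
open import Relation.Unary using (Pred; Decidable)
open import Defs

private
  variable
    m n : ℕ

-- Decidable predicates as subsets, and minimal subsets.

module Comprehension {P : Pred (Fin n) 0ℓ} (P? : Decidable P) where

  subset : Subset n
  subset = tabulate (does ∘ P?)

  ∈⁺ : ∀ {x} → P x → x ∈ subset
  ∈⁺ {x} px =
    lookup⇒[]= x _ (trans (lookup∘tabulate (does ∘ P?) x) (dec-true (P? x) px))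

  ∈⁻ : ∀ {x} → x ∈ subset → P x
  ∈⁻ {x} x∈ = extract (P? x)
    (trans (sym (lookup∘tabulate (does ∘ P?) x)) ([]=⇒lookup x∈))
    where
    extract : (d : Dec (P x)) → does d ≡ true → P x
    extract (yes px) _ = px

-- Well-founded descent along `_⊂_`. Minimality is phrased through intersections to suit families
-- closed under `_∩_`: a point of `W` outside `V` would make `W ∩ V` a strictly smaller set
-- satisfying `P`.
minimalSubset : {P : Pred (Subset n) 0ℓ} → Decidable P → ∀ {U} → P U →
                ∃[ W ] P W × W ⊆ U × (∀ {V} → P (W ∩ V) → W ⊆ V)
minimalSubset {P = P} P? = go (⊂-wellFounded _)
  where
  go : ∀ {U} → Acc _⊂_ U → P U →
       ∃[ W ] P W × W ⊆ U × (∀ {V} → P (W ∩ V) → W ⊆ V)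
  go {U} (acc rec) pU with anySubset? (λ V → V ⊂? U ×-dec P? V)
  ... | yes (V , V⊂U , pV) =
    let (W , pW , W⊆V , min) = go (rec V⊂U) pV
    in W , pW , ⊆-trans W⊆V (proj₁ V⊂U) , min
  ... | no ¬smaller = U , pU , ⊆-refl , λ {V} pU∩V {z} z∈U →
    decidable-stable (z ∈? V) λ z∉V →
      ¬smaller (U ∩ V , (p∩q⊆p U V , z , z∈U , z∉V ∘ p∩q⊆q U V) , pU∩V)

-- Clique covers and simplicial vertices.

module _ (G : Graph n) where

  N[_]? : ∀ v → Decidable (N[_] G v)
  N[ v ]? u = u ≟ v ⊎-dec adj? G v u

  N-sym : ∀ {u v} → N[_] G v u → N[_] G u v
  N-sym = Sum.map sym (symm G)

  clique? : {P : Pred (Fin n) 0ℓ} → Decidable P → Dec (Clique G P)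
  clique? P? = map′ (λ c px py → c _ _ px py) (λ c _ _ → c)
    (all? λ x → all? λ y → P? x →-dec P? y →-dec ¬? (x ≟ y) →-dec adj? G x y)

  simplicial? : Decidable (Simplicial G)
  simplicial? v = clique? N[ v ]?

  -- Unlike a clique cover, this condition mentions no subsets, so it transfers
  -- along isomorphisms directly.
  SimpliciallyCovered : Set
  SimpliciallyCovered =
    ∀ {x y} → Adj G x y → ∃[ v ] Simplicial G v × N[_] G v x × N[_] G v y

  clique∋v⊆N[v] : ∀ {P : Pred (Fin n) 0ℓ} {v x} → Clique G P → P v → P x → N[_] G v x
  clique∋v⊆N[v] {v = v} {x} clique pv px with x ≟ v
  ... | yes x≡v = inj₁ x≡v
  ... | no  x≢v = inj₂ (clique pv px (x≢v ∘ sym))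

  cover⇒simpliciallyCovered : SimplicialCliqueCover G → SimpliciallyCovered
  cover⇒simpliciallyCovered cover xy =
    let open SimplicialCliqueCover cover
        (C , C∈F , x∈C , y∈C) = covers xy
        (v , v∈C , sv)        = simplicial C∈F
    in v , sv
     , clique∋v⊆N[v] {P = _∈ C} (cliques C∈F) v∈C x∈C
     , clique∋v⊆N[v] {P = _∈ C} (cliques C∈F) v∈C y∈C

  simpliciallyCovered⇒cover : SimpliciallyCovered → SimplicialCliqueCover G
  simpliciallyCovered⇒cover covered = record
    -- The largest admissible family; an edge is covered by the closed neighborhood of its
    -- simplicial witness.
    { Family     = λ C → Clique G (_∈ C) × ∃[ v ] v ∈ C × Simplicial G v
    ; family?    = λ C → clique? (_∈? C) ×-dec any? λ v → v ∈? C ×-dec simplicial? v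
    ; cliques    = proj₁
    ; covers     = λ xy →
        let (v , sv , vx , vy) = covered xy
            open Comprehension N[ v ]?
        in subset
         , ( (λ x∈ y∈ → sv (∈⁻ x∈) (∈⁻ y∈))
           , v , ∈⁺ (inj₁ refl) , sv )
         , ∈⁺ vx , ∈⁺ vy
    ; simplicial = proj₂
    }

-- Invariance under isomorphism.

module _ {G : Graph m} {H : Graph n} (G≅H : G ≅ H) where
  open _≅_ G≅H
  open Inverse bijection using (to; from; strictlyInverseˡ; strictlyInverseʳ)

  private
    to-injective : ∀ {x y} → to x ≡ to y → x ≡ y
    to-injective {x} {y} eq =
      trans (sym (strictlyInverseʳ x)) (trans (cong from eq) (strictlyInverseʳ y))

    adj⁺ : ∀ {x y} → Adj G x y → Adj H (to x) (to y)
    adj⁺ = Equivalence.to (adj⇔ _ _)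

    adj⁻ : ∀ {x y} → Adj H (to x) (to y) → Adj G x y
    adj⁻ = Equivalence.from (adj⇔ _ _)

    N⁺ : ∀ {v x} → N[_] G v x → N[_] H (to v) (to x)
    N⁺ = Sum.map (cong to) adj⁺

    N⁻ : ∀ {v x} → N[_] H (to v) (to x) → N[_] G v x
    N⁻ = Sum.map to-injective adj⁻

    simplicial⁻ : ∀ {v} → Simplicial H (to v) → Simplicial G v
    simplicial⁻ sv vx vy x≢y = adj⁻ (sv (N⁺ vx) (N⁺ vy) (x≢y ∘ to-injective))

  simpliciallyCovered-≅ : SimpliciallyCovered H → SimpliciallyCovered G
  simpliciallyCovered-≅ covered {x} {y} xy =
    let (v , sv , vx , vy) = covered (adj⁺ xy)
        -- The witness lies in `H`; writing it as `to (from v)` lets adjacency be reflected back to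
        -- `G`.
        v≡ = sym (strictlyInverseˡ v)
    in from v
     , simplicial⁻ (subst (Simplicial H) v≡ sv)
     , N⁻ (subst (λ w → N[_] H w (to x)) v≡ vx)
     , N⁻ (subst (λ w → N[_] H w (to y)) v≡ vy)

-- From a topology to simplicial vertices.

module _ (τ : Topology n) where

  -- A minimal open set around `x` is least, since its intersection with any other open set around
  -- `x` is again one.
  leastNeighborhood : ∀ x → ∃[ U ] Open τ U × x ∈ U ×
                      (∀ {V} → Open τ V → x ∈ V → U ⊆ V)
  leastNeighborhood x =
    let (U , (oU , x∈U) , _ , min) =
          minimalSubset (λ V → open? τ V ×-dec x ∈? V) (X-open τ , ∈⊤)
    in U , oU , x∈U , λ oV x∈V → min (∩-closed τ oU oV , x∈p∩q⁺ (x∈U , x∈V))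

  ¬separated⇒meet : ∀ {x y U V} → ¬ T₂-Separated τ x y → Open τ U → Open τ V →
                    x ∈ U → y ∈ V → Nonempty (U ∩ V)
  ¬separated⇒meet {U = U} {V} ¬sep oU oV x∈U y∈V =
    decidable-stable (nonempty? (U ∩ V)) λ empty →
      ¬sep (U , V , oU , oV , x∈U , y∈V , empty)

  -- The minimality condition says that W is an atom among the nonempty open sets.
  minimalOpen⇒simplicial :
    ∀ {W z} → Open τ W → (∀ {V} → Open τ V → Nonempty (W ∩ V) → W ⊆ V) → z ∈ W →
    Simplicial (G₂ τ) z
  minimalOpen⇒simplicial {W} {z} oW min z∈W za zb a≢b =
    a≢b , λ (U , V , oU , oV , a∈U , b∈V , empty) →
      empty (z , x∈p∩q⁺ (W⊆nbhd za oU a∈U z∈W , W⊆nbhd zb oV b∈V z∈W))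
    where
    W⊆nbhd : ∀ {u U} → N[_] (G₂ τ) z u → Open τ U → u ∈ U → W ⊆ U
    W⊆nbhd (inj₁ refl)       oU z∈U = min oU (z , x∈p∩q⁺ (z∈W , z∈U))
    W⊆nbhd (inj₂ (_ , ¬sep)) oU u∈U = min oU (¬separated⇒meet ¬sep oW oU z∈W u∈U)

  -- Every open set around `x` contains `U`, hence `z`, so it meets every open set around `z`.
  inLeastNeighborhood⇒N :
    ∀ {x z U} → (∀ {V} → Open τ V → x ∈ V → U ⊆ V) → z ∈ U →
    N[_] (G₂ τ) z x
  inLeastNeighborhood⇒N {x} {z} least z∈U with x ≟ z
  ... | yes x≡z = inj₁ x≡z
  ... | no  x≢z = inj₂ (x≢z ∘ sym , λ (V , V′ , _ , oV′ , z∈V , x∈V′ , empty) →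
    empty (z , x∈p∩q⁺ (z∈V , least oV′ x∈V′ z∈U)))

  G₂-simpliciallyCovered : SimpliciallyCovered (G₂ τ)
  G₂-simpliciallyCovered {x} {y} (_ , ¬sep) =
    let (U , oU , x∈U , leastU) = leastNeighborhood x
        (V , oV , y∈V , leastV) = leastNeighborhood y
        (W , (oW , z , z∈W) , W⊆U∩V , min) =
          minimalSubset (λ S → open? τ S ×-dec nonempty? S)
            (∩-closed τ oU oV , ¬separated⇒meet ¬sep oU oV x∈U y∈V)
        (z∈U , z∈V) = x∈p∩q⁻ U V (W⊆U∩V z∈W)
    in z
     -- `W ∩ S` is open whenever `S` is, so minimality only asks that it be nonempty.
     , minimalOpen⇒simplicial oW (λ oS meet → min (∩-closed τ oW oS , meet)) z∈W
     , inLeastNeighborhood⇒N leastU z∈U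
     , inLeastNeighborhood⇒N leastV z∈V

-- From simplicial vertices to a topology.

module _ (G : Graph n) where

  SimpliciallyClosed : Pred (Subset n) 0ℓ
  SimpliciallyClosed U =
    ∀ {x v} → x ∈ U → Simplicial G v → N[_] G v x → v ∈ U

  simpliciallyClosed? : Decidable SimpliciallyClosed
  simpliciallyClosed? U = map′ (λ c {x} {v} → c x v) (λ c x v → c {x} {v})
    (all? λ x → all? λ v →
      x ∈? U →-dec simplicial? G v →-dec N[_]? G v x →-dec v ∈? U)

  -- Each closure requirement starts from a single point `x`, which is why unions preserve it.
  simplicialTopology : Topology n
  simplicialTopology = record
    { Open     = SimpliciallyClosed
    ; open?    = simpliciallyClosed?
    ; ∅-open   = λ x∈⊥ → contradiction x∈⊥ ∉⊥
    ; X-open   = λ _ _ _ → ∈⊤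
    ; ∪-closed = λ {U} {V} cU cV x∈ sv vx → x∈p∪q⁺
        (Sum.map (λ x∈U → cU x∈U sv vx) (λ x∈V → cV x∈V sv vx) (x∈p∪q⁻ U V x∈))
    ; ∩-closed = λ {U} {V} cU cV x∈ sv vx →
        let (x∈U , x∈V) = x∈p∩q⁻ U V x∈
        in x∈p∩q⁺ (cU x∈U sv vx , cV x∈V sv vx)
    }

  -- The least open neighborhood of `x` in `simplicialTopology`.
  SimplicialHull : Fin n → Pred (Fin n) 0ℓ
  SimplicialHull x z = z ≡ x ⊎ (Simplicial G z × N[_] G z x)

  simplicialHull? : ∀ x → Decidable (SimplicialHull x)
  simplicialHull? x z = z ≟ x ⊎-dec simplicial? G z ×-dec N[_]? G z x

  simplicialHull-open : ∀ x → SimpliciallyClosed (Comprehension.subset (simplicialHull? x))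
  simplicialHull-open x {u} {v} u∈ sv vu = Comprehension.∈⁺ (simplicialHull? x)
    (close (Comprehension.∈⁻ (simplicialHull? x) u∈))
    where
    close : SimplicialHull x u → SimplicialHull x v
    close (inj₁ refl)      = inj₂ (sv , vu)
    -- One round of adding vertices suffices: `v` and `x` both lie in the clique `N[ u ]`, so `x` is
    -- already in `N[ v ]`.
    close (inj₂ (su , ux)) =
      inj₂ (sv , clique∋v⊆N[v] G {P = N[_] G u} su (N-sym G vu) ux)

  -- If `z` is neither `x` nor `y`, it is simplicial with both in its closed neighborhood; otherwise
  -- one of `x`, `y` lies in the closed neighborhood of the other.
  hulls-meet⇒adj : ∀ {x y z} → x ≢ y → SimplicialHull x z → SimplicialHull y z → Adj G x y
  hulls-meet⇒adj x≢y (inj₁ refl) (inj₁ refl)             = contradiction refl x≢y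
  hulls-meet⇒adj x≢y (inj₁ refl) (inj₂ (_ , inj₁ refl))  = contradiction refl x≢y
  hulls-meet⇒adj x≢y (inj₁ refl) (inj₂ (_ , inj₂ xy))    = xy
  hulls-meet⇒adj x≢y (inj₂ (sz , zx)) (inj₁ refl)        = sz zx (inj₁ refl) x≢y
  hulls-meet⇒adj x≢y (inj₂ (sz , zx)) (inj₂ (_ , zy))    = sz zx zy x≢y

  ¬separated⇒adj : ∀ {x y} → x ≢ y → ¬ T₂-Separated simplicialTopology x y → Adj G x y
  ¬separated⇒adj {x} {y} x≢y ¬sep =
    let (z , z∈) = ¬separated⇒meet simplicialTopology ¬sep
          (simplicialHull-open x) (simplicialHull-open y)
          (Comprehension.∈⁺ (simplicialHull? x) (inj₁ refl))
          (Comprehension.∈⁺ (simplicialHull? y) (inj₁ refl))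
        (z∈x , z∈y) = x∈p∩q⁻ _ _ z∈
    in hulls-meet⇒adj x≢y (Comprehension.∈⁻ (simplicialHull? x) z∈x)
                          (Comprehension.∈⁻ (simplicialHull? y) z∈y)

  -- The simplicial vertex witnessing the edge belongs to every open set that contains `x` or `y`.
  adj⇒¬separated : SimpliciallyCovered G → ∀ {x y} → Adj G x y →
                   ¬ T₂-Separated simplicialTopology x y
  adj⇒¬separated covered xy (U , V , cU , cV , x∈U , y∈V , empty) =
    let (v , sv , vx , vy) = covered xy
    in empty (v , x∈p∩q⁺ (cU x∈U sv vx , cV y∈V sv vy))

  simpliciallyCovered⇒𝒢₂ : SimpliciallyCovered G → 𝒢₂ G
  simpliciallyCovered⇒𝒢₂ covered = n , simplicialTopology , record
    { bijection = Identity.↔-id _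
    ; adj⇔      = λ x y → mk⇔
        (λ xy → (λ { refl → irrefl G xy }) , adj⇒¬separated covered xy)
        (λ (x≢y , ¬sep) → ¬separated⇒adj x≢y ¬sep)
    }

𝒢₂⇒simpliciallyCovered : (G : Graph n) → 𝒢₂ G → SimpliciallyCovered G
𝒢₂⇒simpliciallyCovered G (_ , τ , G≅G₂) =
  simpliciallyCovered-≅ G≅G₂ (G₂-simpliciallyCovered τ)

theorem5p1 : ∀ (n : ℕ) (G : Graph n) → 𝒢₂ G ⇔ SimplicialCliqueCover G
theorem5p1 n G = mk⇔
  (simpliciallyCovered⇒cover G ∘ 𝒢₂⇒simpliciallyCovered G)
  (simpliciallyCovered⇒𝒢₂ G ∘ cover⇒simpliciallyCovered G)
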